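{- There exists a constant $C>0$ such that for every natural number $n$ and every natural number $\alpha$ with $5 \log n \leq \alpha \leq n$, there exist $t \geq \frac{1}{C n^5}\, 2^\alpha$ strings $x_1, \ldots, x_t \in \{0,1\}^n$ that are pairwise $\alpha$-independent, i.e. $C(x_i) - C(x_i \mid x_j) \leq \alpha$ for all $i \neq j$.
   Context: $C(x)$ denotes the plain Kolmogorov complexity of the binary string $x$ with respect to a fixed universal Turing machine; $C(x \mid y)$ denotes the conditional plain Kolmogorov complexity of $x$ given $y$ with respect to a fixed universal conditional machine. Logarithms are base $2$. -}

module Defs where

open import Data.Bool.Base using (Bool)
open import Data.Fin.Base using (Fin; zero)
open import Data.Integer.Base as ℤ using (+_)
open import Data.List.Base using (List; []; _∷_; _++_; map; length)
open import Data.List.Properties using (++-identityʳ)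
open import Data.Maybe.Base using (Maybe; just; nothing)
open import Data.Nat.Base using (ℕ; _+_; _≤_; _<_)
open import Data.Nat.Induction using (<-rec)
open import Data.Nat.Properties using (≮⇒≥)
open import Data.Product.Base using (∃; ∃-syntax; _×_; _,_)
open import Relation.Binary.PropositionalEquality using (_≡_; refl; sym; trans; cong)
open import Relation.Nullary.Negation.Core using (¬_)

String : Set
String = List Bool

data Symbol (k : ℕ) : Set where
  blank : Symbol k
  bit   : Bool → Symbol k
  mark  : Fin k → Symbol k

data Move : Set where
  left right stay : Move

-- A two-way infinite tape.  Cells to the left of the head are listed nearest
-- first; all cells beyond either list are blank.
record Tape (k : ℕ) : Set where
  constructor tape
  field
    before : List (Symbol k)
    head   : Symbol k
    after  : List (Symbol k)

open Tape public using (head)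

fromSymbols : ∀ {k} → List (Symbol k) → Tape k
fromSymbols []       = tape [] blank []
fromSymbols (s ∷ ss) = tape [] s ss

write : ∀ {k} → Symbol k → Tape k → Tape k
write s (tape ls _ rs) = tape ls s rs

move : ∀ {k} → Move → Tape k → Tape k
move left  (tape []       s rs)       = tape [] blank (s ∷ rs)
move left  (tape (l ∷ ls) s rs)       = tape ls l (s ∷ rs)
move right (tape ls       s [])       = tape (s ∷ ls) blank []
move right (tape ls       s (r ∷ rs)) = tape (s ∷ ls) r rs
move stay  t                          = t

bits : ∀ {k} → List (Symbol k) → String
bits (bit b ∷ ss) = b ∷ bits ss
bits _            = []

-- The output is the maximal block of bits that starts at the head.
output : ∀ {k} → Tape k → String
output (tape _ s rs) = bits (s ∷ rs)

-- Deterministic single-tape Turing machines; δ q s ≡ nothing means "halt".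
record TM : Set where
  field
    marks  : ℕ
    states : ℕ
    start  : Fin states
    δ      : Fin states → Symbol marks → Maybe (Fin states × Symbol marks × Move)

module _ (M : TM) where
  open TM M

  data RunsTo (q : Fin states) (t : Tape marks) (x : String) : Set where
    halt : δ q (head t) ≡ nothing → output t ≡ x → RunsTo q t x
    step : ∀ {q′ s d} → δ q (head t) ≡ just (q′ , s , d) →
           RunsTo q′ (move d (write s t)) x → RunsTo q t x

  -- M(p) = x
  Computes : String → String → Set
  Computes p x = RunsTo start (fromSymbols (map bit p)) x

  -- M(p , y) = x.  The two arguments are separated by a blank, which occurs
  -- in neither of them.
  ComputesGiven : String → String → String → Set
  ComputesGiven y p x =
    RunsTo start (fromSymbols (map bit p ++ blank ∷ map bit y)) x

-- Universality in the sense of Kolmogorov complexity: every machine is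
-- simulated with programs that are longer by at most an additive constant.
-- In particular this covers machines U for which each M has a prefix e
-- with U(e p) = M(p) for all p.
Universal : TM → Set
Universal U = ∀ M → ∃[ c ] (∀ p x → Computes M p x →
  ∃[ q ] length q ≤ length p + c × Computes U q x)

UniversalConditional : TM → Set
UniversalConditional V = ∀ M → ∃[ c ] (∀ y p x → ComputesGiven M y p x →
  ∃[ q ] length q ≤ length p + c × ComputesGiven V y q x)

IsLeast : (ℕ → Set) → ℕ → Set
IsLeast P k = P k × (∀ m → P m → k ≤ m)

-- D p x reads "p is a description of x".
HasDescription : (String → String → Set) → String → ℕ → Set
HasDescription D x k = ∃[ p ] length p ≡ k × D p x

-- Complexity is not a computable function, so "C(x) = k" and
-- "C(x | y) = k" are relations.
C[_]_≐_ : TM → String → ℕ → Set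
C[ U ] x ≐ k = IsLeast (HasDescription (Computes U) x) k

C[_]_∣_≐_ : TM → String → String → ℕ → Set
C[ V ] x ∣ y ≐ k = IsLeast (HasDescription (ComputesGiven V y) x) k

-- C(x) − C(x | y) ≤ α.  Both values are unique, and for universal machines
-- they exist classically (C-exists and C∣-exists below), so quantifying over them
-- universally is harmless.
Independent : TM → TM → ℕ → String → String → Set
Independent U V α x y =
  ∀ a b → C[ U ] x ≐ a → C[ V ] x ∣ y ≐ b → + a ℤ.- + b ℤ.≤ + α

least : ∀ {P : ℕ → Set} → ∃ P → ¬ ¬ ∃ (IsLeast P)
least {P} (k , pk) noLeast = <-rec (λ m → ¬ P m) none k pk
  where
  none : ∀ m → (∀ {j} → j < m → ¬ P j) → ¬ P m
  none m below pm =
    noLeast (m , pm , λ j pj → ≮⇒≥ (λ j<m → below j<m pj))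

private
  idle : TM
  idle = record { marks = 0 ; states = 1 ; start = zero ; δ = λ _ _ → nothing }

  bits-map : ∀ {k} p (ss : List (Symbol k)) → bits ss ≡ [] →
             bits (map bit p ++ ss) ≡ p
  bits-map []      ss e = e
  bits-map (b ∷ p) ss e = cong (b ∷_) (bits-map p ss e)

  output-input : ∀ {k} (ss : List (Symbol k)) → output (fromSymbols ss) ≡ bits ss
  output-input []      = refl
  output-input (_ ∷ _) = refl

  output-plain : ∀ {k} p → output (fromSymbols {k} (map bit p)) ≡ p
  output-plain p = trans (output-input (map bit p))
    (trans (cong bits (sym (++-identityʳ (map bit p)))) (bits-map p [] refl))

  output-pair : ∀ {k} p y →
                output (fromSymbols {k} (map bit p ++ blank ∷ map bit y)) ≡ p
  output-pair p y = trans (output-input (map bit p ++ blank ∷ map bit y))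
    (bits-map p (blank ∷ map bit y) refl)

C-exists : ∀ U → Universal U → ∀ x → ¬ ¬ (∃[ k ] C[ U ] x ≐ k)
C-exists U univ x with univ idle
... | _ , sim with sim x x (halt refl (output-plain x))
... | q , _ , run = least (length q , q , refl , run)

C∣-exists : ∀ V → UniversalConditional V → ∀ x y →
            ¬ ¬ (∃[ k ] C[ V ] x ∣ y ≐ k)
C∣-exists V univ x y with univ idle
... | _ , sim with sim y x x (halt refl (output-pair x y))
... | q , _ , run = least (length q , q , refl , run)

{-# OPTIONS --safe #-}

-- If C(x) ≤ α then C(x) − C(x | y) ≤ α for every y, so it suffices to find
-- many strings of length n and complexity at most α.  Take x = w 0^m with
-- |w| = k and k + m = n.  A machine rebuilds x from w and a self-delimiting
-- binary code of m, which costs 2 log n + O(1) bits; hence k can be chosen as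
-- α − 2 log n − O(1), giving 2^k ≥ 2^α / O(n²) strings.
module Submission where

open import Defs
open import Data.Nat.Base
  using (ℕ; zero; suc; _+_; _*_; _∸_; _^_; _≤_; _<_; z≤n; s≤s; >-nonZero)
open import Data.Nat.Properties
open import Data.Nat.DivMod using (_divMod_; result)
open import Data.Nat.Tactic.RingSolver using (solve-∀)
open import Data.Fin.Base using (Fin; zero; suc; toℕ)
open import Data.Fin.Properties using (toℕ<n; toℕ-injective)
open import Data.Bool.Base using (Bool; true; false)
open import Data.Integer.Base as ℤ using (+_)
import Data.Integer.Properties as ℤ
open import Data.List.Base as List using (List; []; _∷_; _++_; map; length; [_]; _ʳ++_)
open import Data.List.Properties using (++-identityʳ; ∷ʳ-++)
open import Data.Maybe.Base using (Maybe; just; nothing)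
open import Data.Vec.Base as Vec using (Vec; []; _∷_; toList)
import Data.Vec.Properties as Vec
open import Data.Product.Base using (∃-syntax; _×_; _,_; proj₁; proj₂)
open import Function.Definitions using (Injective)
open import Relation.Binary.PropositionalEquality
  using (_≡_; _≢_; refl; sym; trans; cong; cong₂; subst)
open import Relation.Nullary.Decidable.Core using (yes; no)
open import Relation.Nullary.Negation.Core using (contradiction)

-- Binary numerals.

-- Least significant digit first, so that a borrow travels rightwards, the way the head scans.
value : String → ℕ
value []           = 0
value (false ∷ ds) = value ds * 2
value (true  ∷ ds) = suc (value ds * 2)

-- The width is fixed, with zeros filling the high places, so the length of the code depends on `r`
-- alone.
digits : ∀ r m → m < 2 ^ r → ∃[ ds ] value (toList {n = r} ds) ≡ m
digits zero    m m<1 = [] , sym (n<1⇒n≡0 m<1)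
digits (suc r) m m<2^ with m divMod 2
... | result q zero refl =
  let ds , eq = digits r q (*-cancelʳ-< 2 q _ (subst (q * 2 <_) (*-comm 2 (2 ^ r)) m<2^))
  in false ∷ ds , cong (_* 2) eq
... | result q (suc zero) refl =
  let ds , eq = digits r q (*-cancelʳ-< 2 q _
                  (subst (q * 2 <_) (*-comm 2 (2 ^ r)) (<-trans (n<1+n _) m<2^)))
  in true ∷ ds , cong (λ v → suc (v * 2)) eq

power-of-two-above : ∀ n → 0 < n → ∃[ r ] n < 2 ^ r × 2 ^ r ≤ 2 * n
power-of-two-above (suc zero) _ = 1 , ≤-refl , ≤-refl
power-of-two-above (suc n@(suc _)) _ with power-of-two-above n (s≤s z≤n)
... | r , n<2^r , 2^r≤2n with suc n <? 2 ^ r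
...   | yes 1+n<2^r = r , 1+n<2^r , ≤-trans 2^r≤2n (*-monoʳ-≤ 2 (n≤1+n n))
-- Here `2 ^ r ≤ suc n`, so one doubling stays within `2 * suc n`.
...   | no  1+n≮2^r = suc r , ≤-<-trans n<2^r (^-monoʳ-< 2 ≤-refl (n<1+n r))
                    , *-monoʳ-≤ 2 (≮⇒≥ 1+n≮2^r)

-- The padding machine and its runs.

Sym : Set
Sym = Symbol 0

pattern rewind = zero
pattern flag   = suc zero
pattern digit  = suc (suc zero)
pattern seek   = suc (suc (suc zero))
pattern done   = suc (suc (suc (suc zero)))

-- On 1 d₁ 1 d₂ … 1 dᵣ 0 w, decrements the counter d₁ … dᵣ and appends a 0 to
-- w, as long as the counter is positive; then halts on w.
padder : TM
padder = record { marks = 0 ; states = 5 ; start = rewind ; δ = table }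
  where
  table : Fin 5 → Sym → Maybe (Fin 5 × Sym × Move)
  table rewind (bit b)     = just (rewind , bit b , left)
  table rewind blank       = just (flag , blank , right)
  table flag   (bit true)  = just (digit , bit true , right)
  table flag   (bit false) = just (done , bit false , right)
  table digit  (bit true)  = just (seek , bit false , right)
  table digit  (bit false) = just (flag , bit true , right)
  table seek   (bit b)     = just (seek , bit b , right)
  table seek   blank       = just (rewind , bit false , left)
  table _      _           = nothing

delimit : String → String → String
delimit []       w = false ∷ w
delimit (d ∷ ds) w = true ∷ d ∷ delimit ds w

delimit-++ : ∀ ds w u → delimit ds w ++ u ≡ delimit ds (w ++ u)
delimit-++ []       w u = refl
delimit-++ (d ∷ ds) w u = cong (λ p → true ∷ d ∷ p) (delimit-++ ds w u)

length-delimit : ∀ ds w → length (delimit ds w) ≡ length ds * 2 + suc (length w)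
length-delimit []       w = refl
length-delimit (d ∷ ds) w = cong (λ l → suc (suc l)) (length-delimit ds w)

at : List Sym → List Sym → Tape 0
at ls []       = tape ls blank []
at ls (s ∷ ss) = tape ls s ss

output-at : ∀ ls w → output (at ls (map bit w)) ≡ w
output-at ls []      = refl
output-at ls (b ∷ w) = cong (b ∷_) (bits-bit w)
  where
  bits-bit : ∀ v → bits {0} (map bit v) ≡ v
  bits-bit []      = refl
  bits-bit (c ∷ v) = cong (c ∷_) (bits-bit v)

Runs : Fin 5 → Tape 0 → String → Set
Runs = RunsTo padder

-- The bits l to the left of the head, nearest first, with the blank that
-- marks the left end.
leftPart : String → List Sym
leftPart l = map bit l ++ [ blank ]

-- Splitting on `ss` lets `move right` reduce; either case lands in `at`.
step-right : ∀ {q s q′ s′ x} ls ss → TM.δ padder q s ≡ just (q′ , s′ , right) →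
             Runs q′ (at (s′ ∷ ls) ss) x → Runs q (at ls (s ∷ ss)) x
step-right ls []      e run = step e run
step-right ls (_ ∷ _) e run = step e run

-- The cells left of the head are stored reversed, so `l ʳ++ c ∷ w` is the content read from the
-- left end.
rewind-run : ∀ {x} l c w → Runs flag (at [ blank ] (map bit (l ʳ++ c ∷ w))) x →
             Runs rewind (move left (tape (leftPart l) (bit c) (map bit w))) x
rewind-run []      c w run = step refl run
rewind-run (b ∷ l) c w run = step refl (rewind-run l b (c ∷ w) run)

seek-run : ∀ {x} l w → Runs flag (at [ blank ] (map bit (l ʳ++ w ++ [ false ]))) x →
           Runs seek (at (leftPart l) (map bit w)) x
seek-run l []      run = step refl (rewind-run l false [] run)
seek-run l (b ∷ w) run =
  step-right (leftPart l) (map bit w) refl (seek-run (b ∷ l) w run)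

-- Low zeros become ones until the lowest one absorbs the borrow; `l` collects the cells passed. The
-- continuation accepts any `ds′` of the right value, so the new digits need not be computed in the
-- statement.
decrement-run : ∀ {x v} l ds w → value ds ≡ suc v →
  (∀ ds′ → value ds′ ≡ v →
    Runs flag (at [ blank ] (map bit (l ʳ++ delimit ds′ (w ++ [ false ])))) x) →
  Runs flag (at (leftPart l) (map bit (delimit ds w))) x
decrement-run {x} l (true ∷ ds) w eq run =
  step refl (step-right (leftPart (true ∷ l)) (map bit (delimit ds w)) refl
    (seek-run (false ∷ true ∷ l) (delimit ds w)
      (subst (λ p → Runs flag (at [ blank ] (map bit (l ʳ++ true ∷ false ∷ p))) x)
        (sym (delimit-++ ds w [ false ]))
        (run (false ∷ ds) (suc-injective eq)))))
decrement-run l (false ∷ ds) w eq run with value ds in eq′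
-- 2(u + 1) - 1 = 2u + 1: this digit becomes 1 and the higher ones must drop to `u`.
... | suc u =
  step refl (step-right (leftPart (true ∷ l)) (map bit (delimit ds w)) refl
    (decrement-run (true ∷ true ∷ l) ds w eq′ λ ds′ eq″ →
      run (true ∷ ds′) (trans (cong (λ u → suc (u * 2)) eq″) (suc-injective eq))))

-- The vain search for a 1 overwrites the counter with ones. This is harmless: output starts at the
-- head, which stops just past the delimiter.
exhausted-run : ∀ ls ds w → value ds ≡ 0 →
                Runs flag (at ls (map bit (delimit ds w))) w
exhausted-run ls []           w eq =
  step-right ls (map bit w) refl (halt refl (output-at (bit false ∷ ls) w))
exhausted-run ls (false ∷ ds) w eq =
  step refl (step-right (bit true ∷ ls) (map bit (delimit ds w)) refl
    (exhausted-run (bit true ∷ bit true ∷ ls) ds w (m*n≡0⇒m≡0 (value ds) 2 eq)))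

-- Induction is on the value, since each round replaces the digits and moves one `false` into `w`.
pad-run : ∀ v ds w → value ds ≡ v →
  Runs flag (at [ blank ] (map bit (delimit ds w))) (w ++ List.replicate v false)
pad-run zero    ds w eq rewrite ++-identityʳ w = exhausted-run [ blank ] ds w eq
pad-run (suc v) ds w eq rewrite sym (∷ʳ-++ w false (List.replicate v false)) =
  decrement-run [] ds w eq λ ds′ → pad-run v ds′ (w ++ [ false ])

padder-computes : ∀ ds w →
  Computes padder (delimit ds w) (w ++ List.replicate (value ds) false)
-- Two steps, off the left end and back, put the end-marking blank on the tape.
padder-computes ds@[]      w = step refl (step refl (pad-run (value ds) ds w refl))
padder-computes ds@(_ ∷ _) w = step refl (step refl (pad-run (value ds) ds w refl))

-- Simple strings and the size of the family.

-- Subtracting the natural number `b` cannot raise `a`, and `a` is at most the length of `p`.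
independent-of-simple : ∀ U V {α x} y p → Computes U p x → length p ≤ α →
                        Independent U V α x y
independent-of-simple U V y p run p≤α a b (_ , least-a) _ =
  ℤ.i≤j⇒i-k≤j (+ b) (ℤ.+≤+ (≤-trans (least-a _ (p , refl , run)) p≤α))

padded : ∀ {k} m → Vec Bool k → Vec Bool (k + m)
padded m w = w Vec.++ Vec.replicate m false

padded-description : ∀ {k} r m (w : Vec Bool k) → m < 2 ^ r →
  ∃[ p ] length p ≡ r * 2 + suc k × Computes padder p (toList (padded m w))
padded-description {k} r m w m<2^r with digits r m m<2^r
... | ds , refl = delimit (toList ds) (toList w)
    , trans (length-delimit (toList ds) (toList w))
        (cong₂ (λ a b → a * 2 + suc b) (Vec.length-toList ds) (Vec.length-toList w))
    , subst (Computes padder _) (sym toList-padded) (padder-computes (toList ds) (toList w))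
  where
  toList-padded : toList (padded m w) ≡ toList w ++ List.replicate m false
  toList-padded = trans (Vec.toList-++ w _) (cong (toList w ++_) (Vec.toList-replicate m false))

word : ∀ k → Fin (2 ^ k) → Vec Bool k
word k i = proj₁ (digits k (toℕ i) (toℕ<n i))

word-injective : ∀ k → Injective _≡_ _≡_ (word k)
word-injective k {i} {j} eq = toℕ-injective
  (trans (sym (value-word i)) (trans (cong (λ w → value (toList w)) eq) (value-word j)))
  where
  value-word : ∀ i → value (toList (word k i)) ≡ toℕ i
  value-word i = proj₂ (digits k (toℕ i) (toℕ<n i))

Fin-1-unique : ∀ {t} → t ≡ 1 → (i j : Fin t) → i ≡ j
Fin-1-unique refl zero zero = refl

-- The overhead `r * 2 + suc c` counts two bits per digit, the delimiter and the simulation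
-- constant. As `2 ^ r ≤ 2 * n`, it costs a factor of at most 4n² · 2^(c+1).
family-size : ∀ r n c α → 0 < n → 2 ^ r ≤ 2 * n →
  2 ^ α ≤ 2 ^ (3 + c) * n ^ 5 * 2 ^ (α ∸ (r * 2 + suc c))
family-size r n c α 0<n 2^r≤2n = begin
  -- Truncated subtraction keeps this valid when `α < e`.
  2 ^ α                            ≤⟨ ^-monoʳ-≤ 2 (m≤n+m∸n α e) ⟩
  2 ^ (e + k)                      ≡⟨ ^-distribˡ-+-* 2 e k ⟩
  2 ^ e * 2 ^ k                    ≤⟨ *-monoˡ-≤ (2 ^ k) 2^e≤ ⟩
  2 ^ (3 + c) * n ^ 5 * 2 ^ k      ∎
  where
  open ≤-Reasoning
  e k : ℕ
  e = r * 2 + suc c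
  k = α ∸ e

  rearrange : ∀ n d → 2 * n * (2 * n * 1) * d ≡ 2 * (2 * d) * (n * (n * 1))
  rearrange = solve-∀

  2^e≤ : 2 ^ e ≤ 2 ^ (3 + c) * n ^ 5
  2^e≤ = begin
    2 ^ e                     ≡⟨ ^-distribˡ-+-* 2 (r * 2) (suc c) ⟩
    2 ^ (r * 2) * 2 ^ suc c   ≡⟨ cong (_* 2 ^ suc c) (^-*-assoc 2 r 2) ⟨
    (2 ^ r) ^ 2 * 2 ^ suc c   ≤⟨ *-monoˡ-≤ (2 ^ suc c) (^-monoˡ-≤ 2 2^r≤2n) ⟩
    (2 * n) ^ 2 * 2 ^ suc c   ≡⟨ rearrange n (2 ^ suc c) ⟩
    2 ^ (3 + c) * n ^ 2       ≤⟨ *-monoʳ-≤ (2 ^ (3 + c))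
                                   (^-monoʳ-≤ n {{>-nonZero 0<n}} {2} {5} (s≤s (s≤s z≤n))) ⟩
    2 ^ (3 + c) * n ^ 5       ∎

theorem5 : (U V : TM) → Universal U → UniversalConditional V →
    ∃[ C ] 0 < C × (∀ (n α : ℕ) → 0 < n → n ^ 5 ≤ 2 ^ α → α ≤ n →
    ∃[ t ] 2 ^ α ≤ C * n ^ 5 * t ×
    (∃[ x ] Injective {A = Fin t} {B = Vec Bool n} _≡_ _≡_ x ×
    (∀ i j → i ≢ j → Independent U V α (toList (x i)) (toList (x j)))))
theorem5 U V univ _ with univ padder
-- `c` is obtained before `n` and `α`, so the constant is uniform in both.
... | c , simulate = 2 ^ (3 + c) , m^n>0 2 (3 + c) , family
  where
  family : ∀ n α → 0 < n → n ^ 5 ≤ 2 ^ α → α ≤ n →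
    ∃[ t ] 2 ^ α ≤ 2 ^ (3 + c) * n ^ 5 * t ×
    (∃[ x ] Injective {A = Fin t} {B = Vec Bool n} _≡_ _≡_ x ×
    (∀ i j → i ≢ j → Independent U V α (toList (x i)) (toList (x j))))
  family n α 0<n _ α≤n with power-of-two-above n 0<n
  ... | r , n<2^r , 2^r≤2n
      -- `k ≤ α ≤ n` leaves room for `m` zeros; matching `refl` turns `n` into `k + m`.
      with m≤n⇒∃[o]m+o≡n (≤-trans (m∸n≤m α (r * 2 + suc c)) α≤n)
  ...   | m , refl = 2 ^ k , family-size r (k + m) c α 0<n 2^r≤2n
                   , x , (λ eq → word-injective k (Vec.++-injectiveˡ _ _ eq)) , independent
    where
    e k : ℕ
    e = r * 2 + suc c
    k = α ∸ e  -- for α < e this is 0 and the family has a single member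

    x : Fin (2 ^ k) → Vec Bool (k + m)
    x i = padded m (word k i)

    total-length : e ≤ α → r * 2 + suc k + c ≡ α
    total-length e≤α = trans (rearrange (r * 2) k c) (m∸n+n≡m e≤α)
      where
      rearrange : ∀ a k c → a + suc k + c ≡ k + (a + suc c)
      rearrange = solve-∀

    independent : ∀ i j → i ≢ j → Independent U V α (toList (x i)) (toList (x j))
    independent i j i≢j with e ≤? α
    ... | no  e≰α = contradiction
          (Fin-1-unique (cong (2 ^_) (m≤n⇒m∸n≡0 (≰⇒≥ e≰α))) i j) i≢j
    ... | yes e≤α with padded-description r m (word k i) (≤-<-trans (m≤n+m m k) n<2^r)
    ...   | p , |p|≡ , p-run with simulate p _ p-run
    ...     | q , |q|≤ , q-run = independent-of-simple U V (toList (x j)) q q-run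
              (≤-trans |q|≤ (≤-reflexive (trans (cong (_+ c) |p|≡) (total-length e≤α))))
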